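{- If cancellation is not allowed, then no randomized policy achieves a constant robustness ratio for the knapsack problem with an unknown capacity. That is, for every constant $\alpha>0$ there is an instance of the knapsack problem with an unknown capacity for which no randomized policy (without cancellation) is $\alpha$-robust.
   Context: Knapsack problem with an unknown capacity: an instance is a finite set $I$ of items, each item $i$ having a positive integer size $s(i)$ and a nonnegative weight $w(i)$; the objective is $f(X)=\sum_{i\in X}w(i)$. The capacity $C$ is unknown. Items are tried one at a time, each at most once. When item $i$ is tried and the current knapsack content is $X$, we learn whether $s(X)+s(i)\le C$, where $s(X)=\sum_{j\in X}s(j)$. If so, $i$ is irrevocably added to $X$; otherwise (without cancellation) $i$ is discarded, the process stops, and the output is $X$. An adaptive policy is a binary decision tree specifying the next item to try depending on the observations so far (without cancellation this amounts to a sequence of the items); a randomized policy is a probability distribution over such policies. Let $\mathrm{ALG}_C$ be the (random) output when the capacity is $C$ and let $\mathrm{OPT}_C$ maximize $f(X)$ over $X\subseteq I$ with $s(X)\le C$. The policy is $\alpha$-robust if $\mathbb{E}[f(\mathrm{ALG}_C)]\ge\alpha f(\mathrm{OPT}_C)$ for every $C\in\mathbb{R}_+$. -}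

module Defs where

open import Algebra.Bundles using (CommutativeRing)
import Algebra.Definitions.RawMonoid as RawMonoidDefs
open import Data.Bool.Base using (if_then_else_)
open import Data.Fin.Base using (Fin)
open import Data.Fin.Subset using (Subset; _∉_; _∪_; ⁅_⁆; ⊥)
open import Data.Nat.Base as ℕ using (ℕ)
open import Data.Product.Base using (_×_; ∃-syntax)
open import Data.Vec.Base using (lookup)
open import Level using (Level; _⊔_; suc)
open import Relation.Binary.Core using (Rel)
open import Relation.Binary.Structures using (IsDecTotalOrder)
open import Relation.Nullary using (¬_; does)

-- The standard library has no real numbers.  Weights, probabilities,
-- capacities and the ratio α range over an arbitrary Archimedean ordered
-- field; the classical real numbers are such a field, and so is ℚ.
record ArchimedeanOrderedField (c ℓ₁ ℓ₂ : Level) : Set (suc (c ⊔ ℓ₁ ⊔ ℓ₂)) where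
  infix 4 _≤_ _<_
  field
    commutativeRing : CommutativeRing c ℓ₁
  open CommutativeRing commutativeRing public
  field
    _≤_             : Rel Carrier ℓ₂
    isDecTotalOrder : IsDecTotalOrder _≈_ _≤_
    0≉1             : ¬ (0# ≈ 1#)
    inverse         : ∀ x → ¬ (x ≈ 0#) → ∃[ y ] (x * y ≈ 1#)
    +-monoˡ-≤       : ∀ z {x y} → x ≤ y → (x + z) ≤ (y + z)
    *-nonNeg        : ∀ {x y} → 0# ≤ x → 0# ≤ y → 0# ≤ (x * y)

  open IsDecTotalOrder isDecTotalOrder public using (_≤?_)

  _<_ : Rel Carrier (ℓ₁ ⊔ ℓ₂)
  x < y = x ≤ y × ¬ (x ≈ y)

  open RawMonoidDefs +-rawMonoid public using (sum)

  fromℕ : ℕ → Carrier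
  fromℕ n = RawMonoidDefs._×_ +-rawMonoid n 1#

  field
    archimedean : ∀ x → ∃[ n ] (x ≤ fromℕ n)

module Knapsack {c ℓ₁ ℓ₂ : Level} (K : ArchimedeanOrderedField c ℓ₁ ℓ₂) where
  open ArchimedeanOrderedField K

  record Instance : Set (c ⊔ ℓ₂) where
    field
      items         : ℕ
      size          : Fin items → ℕ
      size-positive : ∀ i → 0 ℕ.< size i
      weight        : Fin items → Carrier
      weight-nonNeg : ∀ i → 0# ≤ weight i

    Item : Set
    Item = Fin items

    -- s(X)
    totalSize : Subset items → ℕ
    totalSize X =
      RawMonoidDefs.sum ℕ.+-0-rawMonoid (λ i → if lookup X i then size i else 0)

    -- f(X)
    value : Subset items → Carrier
    value X = sum (λ i → if lookup X i then weight i else 0#)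

  module _ (I : Instance) where
    open Instance I

    -- Binary decision trees trying every item at most once on each path;
    -- the index is the set of items tried so far.  The two subtrees of a
    -- node are for the observations "fits" and "does not fit".
    data DecisionTree (tried : Subset items) : Set where
      stop : DecisionTree tried
      try  : (i : Item) → i ∉ tried →
             (fits overflows : DecisionTree (tried ∪ ⁅ i ⁆)) →
             DecisionTree tried

    Policy : Set
    Policy = DecisionTree ⊥

    -- Without cancellation the first item that does not fit ends the
    -- process, so the "does not fit" subtree is never entered.
    run : Carrier → Subset items → ∀ {tried} → DecisionTree tried → Subset items
    run C X stop           = X
    run C X (try i _ t _) =
      if does (fromℕ (totalSize X ℕ.+ size i) ≤? C)
      then run C (X ∪ ⁅ i ⁆) t
      else X

    output : Carrier → Policy → Subset items
    output C = run C ⊥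

    -- There are only finitely many policies, so every distribution on them
    -- is a finite list of policies with probabilities.
    record RandomizedPolicy : Set (c ⊔ ℓ₁ ⊔ ℓ₂) where
      field
        outcomes    : ℕ
        policy      : Fin outcomes → Policy
        prob        : Fin outcomes → Carrier
        prob-nonNeg : ∀ k → 0# ≤ prob k
        prob-sum    : sum prob ≈ 1#

      -- 𝔼[f(ALG_C)]
      expectedValue : Carrier → Carrier
      expectedValue C = sum (λ k → prob k * value (output C (policy k)))

    Feasible : Carrier → Subset items → Set ℓ₂
    Feasible C X = fromℕ (totalSize X) ≤ C

    IsOPT : Carrier → Subset items → Set ℓ₂
    IsOPT C X = Feasible C X × (∀ Y → Feasible C Y → value Y ≤ value X)

    Robust : Carrier → RandomizedPolicy → Set (c ⊔ ℓ₂)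
    Robust α P = ∀ C → 0# ≤ C → ∀ OPT → IsOPT C OPT →
                 (α * value OPT) ≤ RandomizedPolicy.expectedValue P C

{-# OPTIONS --safe #-}

-- Take M = D + 1 items, item i with size i + 1 and weight Mⁱ.  At capacity
-- i + 1 the optimum is {i}, and a policy can pack item i only by trying it
-- first; otherwise it packs lighter items only, of total weight less than
-- Mⁱ / D.  If q i is the probability that item i is tried first, the expected
-- value is thus at most Mⁱ (q i + 1/D), and α-robustness forces q i ≥ α - 1/D.
-- For D α ≥ 2 this gives D (q i) ≥ 1 for each of the D + 1 items, although
-- the q i add up to at most 1.
module Submission where

open import Defs
import Algebra.Definitions.RawMonoid as RawMonoidDefs
import Algebra.Properties.CommutativeSemigroup as CommutativeSemigroupProperties
import Algebra.Properties.Monoid.Mult as MonoidMult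
import Algebra.Properties.Ring as RingProperties
import Algebra.Properties.Semiring.Mult as SemiringMult
import Algebra.Properties.Semiring.Sum as SemiringSum
open import Data.Bool.Base using (true; false; if_then_else_)
open import Data.Bool.Properties using (if-float)
open import Data.Fin.Base using (Fin; zero; suc; toℕ)
open import Data.Fin.Properties as Fin using (toℕ-injective)
open import Data.Fin.Subset
  using (Subset; inside; outside; _∈_; _⊆_; _∪_; ⁅_⁆; ⊥)
open import Data.Fin.Subset.Properties
  using (_∈?_; ∉⊥; x∈⁅x⁆; x∈⁅y⁆⇒x≡y; p⊆p∪q; q⊆p∪q; drop-∷-⊆)
open import Data.Nat.Base as ℕ using (ℕ; zero; suc; z≤n; s≤s)
import Data.Nat.Properties as ℕ
open import Data.Product.Base using (Σ-syntax; ∃-syntax; _×_; _,_)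
open import Data.Sum.Base using (inj₁; inj₂)
open import Data.Vec.Base using (lookup; []; _∷_; here; there)
open import Data.Vec.Properties using ([]=⇒lookup)
open import Function.Base using (_∘_; const)
open import Relation.Binary.Bundles using (Poset)
open import Relation.Binary.PropositionalEquality as ≡ using (_≡_; _≢_)
import Relation.Binary.Reasoning.PartialOrder as PartialOrderReasoning
open import Relation.Binary.Structures using (IsDecTotalOrder)
open import Relation.Nullary using (¬_; yes; no; contradiction)
open import Relation.Nullary.Decidable using (decidable-stable)

-- Totals of natural-number functions over subsets.

module SubsetTotals where
  open import Data.Nat.Base using (_+_; _*_; _^_; _≤_; _<_)
  open ℕ.≤-Reasoning

  total : ∀ {n} → (Fin n → ℕ) → Subset n → ℕ
  total f X =
    RawMonoidDefs.sum ℕ.+-0-rawMonoid (λ i → if lookup X i then f i else 0)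

  total-⊥ : ∀ {n} (f : Fin n → ℕ) → total f ⊥ ≡ 0
  total-⊥ {zero}  f = ≡.refl
  total-⊥ {suc n} f = total-⊥ (f ∘ suc)

  total-⁅⁆ : ∀ {n} (f : Fin n → ℕ) i → total f ⁅ i ⁆ ≡ f i
  total-⁅⁆ f zero    = ≡.trans (≡.cong (f zero +_) (total-⊥ (f ∘ suc))) (ℕ.+-identityʳ _)
  total-⁅⁆ f (suc i) = total-⁅⁆ (f ∘ suc) i

  total-mono-⊆ : ∀ {n} (f : Fin n → ℕ) {X Y : Subset n} → X ⊆ Y → total f X ≤ total f Y
  total-mono-⊆ f {[]}          {[]}          X⊆Y = z≤n
  total-mono-⊆ f {outside ∷ X} {y ∷ Y}       X⊆Y =
    ℕ.≤-trans (total-mono-⊆ (f ∘ suc) (drop-∷-⊆ X⊆Y)) (ℕ.m≤n+m _ _)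
  total-mono-⊆ f {inside ∷ X}  {inside ∷ Y}  X⊆Y =
    ℕ.+-monoʳ-≤ (f zero) (total-mono-⊆ (f ∘ suc) (drop-∷-⊆ X⊆Y))
  total-mono-⊆ f {inside ∷ X}  {outside ∷ Y} X⊆Y with () ← X⊆Y here

  total-∪ : ∀ {n} (f : Fin n → ℕ) (X Y : Subset n) →
            total f (X ∪ Y) ≤ total f X + total f Y
  total-∪ f []            []            = z≤n
  total-∪ f (outside ∷ X) (outside ∷ Y) = total-∪ (f ∘ suc) X Y
  total-∪ f (inside ∷ X)  (outside ∷ Y) = begin
    f zero + total (f ∘ suc) (X ∪ Y)                       ≤⟨ ℕ.+-monoʳ-≤ (f zero) (total-∪ (f ∘ suc) X Y) ⟩
    f zero + (total (f ∘ suc) X + total (f ∘ suc) Y)       ≡⟨ ℕ.+-assoc (f zero) _ _ ⟨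
    f zero + total (f ∘ suc) X + total (f ∘ suc) Y         ∎
  total-∪ f (outside ∷ X) (inside ∷ Y)  = begin
    f zero + total (f ∘ suc) (X ∪ Y)                       ≤⟨ ℕ.+-monoʳ-≤ (f zero) (total-∪ (f ∘ suc) X Y) ⟩
    f zero + (total (f ∘ suc) X + total (f ∘ suc) Y)       ≡⟨ x∙yz≈y∙xz (f zero) (total (f ∘ suc) X) _ ⟩
    total (f ∘ suc) X + (f zero + total (f ∘ suc) Y)       ∎
    where open CommutativeSemigroupProperties ℕ.+-commutativeSemigroup
  total-∪ f (inside ∷ X)  (inside ∷ Y)  = begin
    f zero + total (f ∘ suc) (X ∪ Y)                       ≤⟨ ℕ.+-monoʳ-≤ (f zero) (total-∪ (f ∘ suc) X Y) ⟩
    f zero + (total (f ∘ suc) X + total (f ∘ suc) Y)       ≡⟨ ℕ.+-assoc (f zero) _ _ ⟨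
    f zero + total (f ∘ suc) X + total (f ∘ suc) Y         ≤⟨ ℕ.+-monoʳ-≤ (f zero + total (f ∘ suc) X) (ℕ.m≤n+m _ (f zero)) ⟩
    f zero + total (f ∘ suc) X + (f zero + total (f ∘ suc) Y) ∎

  total-∈ : ∀ {n} (f : Fin n → ℕ) {X i} → i ∈ X → f i ≤ total f X
  total-∈ f here        = ℕ.m≤m+n _ _
  total-∈ f (there i∈X) = ℕ.≤-trans (total-∈ (f ∘ suc) i∈X) (ℕ.m≤n+m _ _)

  -- Serves to show that an item filling the capacity leaves no room for a second one.
  total-∈₂ : ∀ {n} (f : Fin n → ℕ) {X i j} → i ∈ X → j ∈ X → i ≢ j →
             f i + f j ≤ total f X
  total-∈₂ f here        here        i≢j = contradiction ≡.refl i≢j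
  total-∈₂ f here        (there j∈X) i≢j = ℕ.+-monoʳ-≤ (f zero) (total-∈ (f ∘ suc) j∈X)
  total-∈₂ f (there i∈X) here        i≢j =
    ℕ.≤-trans (ℕ.≤-reflexive (ℕ.+-comm _ (f zero)))
              (ℕ.+-monoʳ-≤ (f zero) (total-∈ (f ∘ suc) i∈X))
  total-∈₂ f (there i∈X) (there j∈X) i≢j =
    ℕ.≤-trans (total-∈₂ (f ∘ suc) i∈X j∈X (i≢j ∘ ≡.cong suc)) (ℕ.m≤n+m _ _)

  total-*ˡ : ∀ {n} m (f : Fin n → ℕ) X → total (λ i → m * f i) X ≡ m * total f X
  total-*ˡ m f []            = ≡.sym (ℕ.*-zeroʳ m)
  total-*ˡ m f (outside ∷ X) = total-*ˡ m (f ∘ suc) X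
  total-*ˡ m f (inside ∷ X)  =
    ≡.trans (≡.cong (m * f zero +_) (total-*ˡ m (f ∘ suc) X))
            (≡.sym (ℕ.*-distribˡ-+ m _ _))

  -- The total is a number in base `suc d` whose digits are 0 or 1, in positions below `i`. Even
  -- with every digit 1 it is the geometric sum, which `d` times makes `suc d ^ i` minus 1. The
  -- induction on `i` splits off the lowest digit.
  total-^-< : ∀ d i {n} (X : Subset n) → (∀ {j} → j ∈ X → toℕ j < i) →
              d * total (λ j → suc d ^ toℕ j) X < suc d ^ i
  -- `X` can have any length here, but no index lies below 0, so `X` has no members.
  total-^-< d zero X X<0 = s≤s (begin
    d * total w X  ≤⟨ ℕ.*-monoʳ-≤ d (total-mono-⊆ w {X} {⊥} (λ j∈X → contradiction (X<0 j∈X) λ())) ⟩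
    d * total w ⊥  ≡⟨ ≡.cong (d *_) (total-⊥ w) ⟩
    d * 0          ≡⟨ ℕ.*-zeroʳ d ⟩
    0              ∎)
    where w = λ j → suc d ^ toℕ j
  total-^-< d (suc i) []      X<i = ℕ.≤-trans (s≤s (ℕ.≤-reflexive (ℕ.*-zeroʳ d))) (ℕ.m^n>0 (suc d) (suc i))
  total-^-< d (suc i) (x ∷ X) X<i = begin
    -- The head has weight 1 and every exponent in the tail is one higher than in the recursive
    -- call, so `suc d` factors out of the tail.
    suc (d * (b + total (λ j → suc d * suc d ^ toℕ j) X))  ≡⟨ ≡.cong (λ t → suc (d * (b + t))) (total-*ˡ (suc d) _ X) ⟩
    suc (d * (b + suc d * t))    ≤⟨ s≤s (ℕ.*-monoʳ-≤ d (ℕ.+-monoˡ-≤ _ (b≤1 x))) ⟩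
    suc (d * (1 + suc d * t))    ≡⟨ ≡.cong suc (ℕ.*-suc d (suc d * t)) ⟩
    -- The 1 coming from the strict inequality joins the `d` from the head to give a further factor
    -- `suc d`, which restores the strict form of the induction hypothesis.
    suc d + d * (suc d * t)      ≡⟨ ≡.cong (suc d +_) (x∙yz≈y∙xz d (suc d) t) ⟩
    suc d + suc d * (d * t)      ≡⟨ ℕ.*-suc (suc d) (d * t) ⟨
    suc d * suc (d * t)          ≤⟨ ℕ.*-monoʳ-≤ (suc d) (total-^-< d i X (λ j∈X → ℕ.≤-pred (X<i (there j∈X)))) ⟩
    suc d * suc d ^ i            ∎
    where
    open CommutativeSemigroupProperties ℕ.*-commutativeSemigroup
    t = total (λ j → suc d ^ toℕ j) X
    b = if x then 1 else 0
    b≤1 : ∀ x → (if x then 1 else 0) ≤ 1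
    b≤1 true  = s≤s z≤n
    b≤1 false = z≤n

open SubsetTotals

-- Arithmetic of ordered fields and the embedding of the naturals.

module OrderedFieldProperties {c ℓ₁ ℓ₂} (K : ArchimedeanOrderedField c ℓ₁ ℓ₂) where
  open ArchimedeanOrderedField K hiding (sum; zero)
  open IsDecTotalOrder isDecTotalOrder public using ()
    renaming ( isPartialOrder to ≤-isPartialOrder; refl to ≤-refl; trans to ≤-trans
             ; reflexive to ≤-reflexive; antisym to ≤-antisym; total to ≤-total )
  open RingProperties ring using (-‿distribˡ-*; -‿involutive)
  open SemiringSum semiring public
  open SemiringMult semiring public using (×1-homo-*)
  open MonoidMult +-monoid public using (×-homo-+; ×-homo-1; ×-congˡ)
  open CommutativeSemigroupProperties *-commutativeSemigroup public using (x∙yz≈y∙xz)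

  ≤-poset : Poset c ℓ₁ ℓ₂
  ≤-poset = record { isPartialOrder = ≤-isPartialOrder }

  open PartialOrderReasoning ≤-poset public

  +-monoʳ-≤ : ∀ z {x y} → x ≤ y → z + x ≤ z + y
  +-monoʳ-≤ z {x} {y} x≤y = begin
    z + x  ≈⟨ +-comm z x ⟩
    x + z  ≤⟨ +-monoˡ-≤ z x≤y ⟩
    y + z  ≈⟨ +-comm y z ⟩
    z + y  ∎

  +-mono-≤ : ∀ {x y u v} → x ≤ y → u ≤ v → x + u ≤ y + v
  +-mono-≤ x≤y u≤v = ≤-trans (+-monoˡ-≤ _ x≤y) (+-monoʳ-≤ _ u≤v)

  +-cancelʳ-≤ : ∀ z {x y} → x + z ≤ y + z → x ≤ y
  +-cancelʳ-≤ z {x} {y} x+z≤y+z = begin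
    x              ≈⟨ cancel x ⟨
    x + z + - z    ≤⟨ +-monoˡ-≤ (- z) x+z≤y+z ⟩
    y + z + - z    ≈⟨ cancel y ⟩
    y              ∎
    where
    cancel : ∀ x → x + z + - z ≈ x
    cancel x = trans (+-assoc x z (- z)) (trans (+-congˡ (-‿inverseʳ z)) (+-identityʳ x))

  -- After adding `z * - x` to both sides, what remains is that `z * (y + - x)` is a product of
  -- nonnegative factors.
  *-monoˡ-≤ : ∀ {z} → 0# ≤ z → ∀ {x y} → x ≤ y → z * x ≤ z * y
  *-monoˡ-≤ {z} 0≤z {x} {y} x≤y = +-cancelʳ-≤ (z * - x) (begin
    z * x + z * - x  ≈⟨ distribˡ z x (- x) ⟨
    z * (x + - x)    ≈⟨ *-congˡ (-‿inverseʳ x) ⟩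
    z * 0#           ≈⟨ zeroʳ z ⟩
    0#               ≤⟨ *-nonNeg 0≤z (≤-trans (≤-reflexive (sym (-‿inverseʳ x))) (+-monoˡ-≤ (- x) x≤y)) ⟩
    z * (y + - x)    ≈⟨ distribˡ z y (- x) ⟩
    z * y + z * - x  ∎)

  -- By totality only `y ≤ x` needs work. Then the two products bound each other, so they are equal,
  -- and the inverse of `z` gives `x ≈ y`.
  *-cancelˡ-≤ : ∀ {z} → 0# < z → ∀ {x y} → z * x ≤ z * y → x ≤ y
  *-cancelˡ-≤ {z} (0≤z , 0≉z) {x} {y} zx≤zy with ≤-total x y
  ... | inj₁ x≤y = x≤y
  ... | inj₂ y≤x with z⁻¹ , zz⁻¹≈1 ← inverse z (0≉z ∘ sym) = ≤-reflexive (begin-equality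
    x              ≈⟨ cancel x ⟨
    z⁻¹ * (z * x)  ≈⟨ *-congˡ (≤-antisym zx≤zy (*-monoˡ-≤ 0≤z y≤x)) ⟩
    z⁻¹ * (z * y)  ≈⟨ cancel y ⟩
    y              ∎)
    where
    cancel : ∀ x → z⁻¹ * (z * x) ≈ x
    cancel x = begin-equality
      z⁻¹ * (z * x)  ≈⟨ *-assoc z⁻¹ z x ⟨
      z⁻¹ * z * x    ≈⟨ *-congʳ (trans (*-comm z⁻¹ z) zz⁻¹≈1) ⟩
      1# * x         ≈⟨ *-identityˡ x ⟩
      x              ∎

  -- If 1 were at most 0, then -1 would be nonnegative, and 1 is its square.
  0≤1 : 0# ≤ 1#
  0≤1 with ≤-total 0# 1#
  ... | inj₁ 0≤1 = 0≤1
  ... | inj₂ 1≤0 = begin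
    0#           ≤⟨ *-nonNeg 0≤-1 0≤-1 ⟩
    - 1# * - 1#  ≈⟨ -‿distribˡ-* 1# (- 1#) ⟨
    - (1# * - 1#) ≈⟨ -‿cong (*-identityˡ (- 1#)) ⟩
    - - 1#       ≈⟨ -‿involutive 1# ⟩
    1#           ∎
    where
    0≤-1 : 0# ≤ - 1#
    0≤-1 = begin
      0#         ≈⟨ -‿inverseʳ 1# ⟨
      1# + - 1#  ≤⟨ +-monoˡ-≤ (- 1#) 1≤0 ⟩
      0# + - 1#  ≈⟨ +-identityˡ (- 1#) ⟩
      - 1#       ∎

  0≤fromℕ : ∀ n → 0# ≤ fromℕ n
  0≤fromℕ zero    = ≤-refl
  0≤fromℕ (suc n) = begin
    0#            ≈⟨ +-identityˡ 0# ⟨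
    0# + 0#       ≤⟨ +-mono-≤ 0≤1 (0≤fromℕ n) ⟩
    1# + fromℕ n  ∎

  fromℕ-mono-≤ : ∀ {m n} → m ℕ.≤ n → fromℕ m ≤ fromℕ n
  fromℕ-mono-≤ {n = n} z≤n = 0≤fromℕ n
  fromℕ-mono-≤ (s≤s m≤n)   = +-monoʳ-≤ 1# (fromℕ-mono-≤ m≤n)

  -- Otherwise `suc n` is at most `m`, so 1 + n is at most n in the field. This forces 1 to be at
  -- most 0, against `0≤1` and `0≉1`.
  fromℕ-cancel-≤ : ∀ {m n} → fromℕ m ≤ fromℕ n → m ℕ.≤ n
  fromℕ-cancel-≤ {m} {n} fm≤fn = decidable-stable (m ℕ.≤? n) λ m≰n →
    0≉1 (≤-antisym 0≤1 (+-cancelʳ-≤ (fromℕ n) (begin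
      1# + fromℕ n  ≤⟨ fromℕ-mono-≤ (ℕ.≰⇒> m≰n) ⟩
      fromℕ m       ≤⟨ fm≤fn ⟩
      fromℕ n       ≈⟨ +-identityˡ (fromℕ n) ⟨
      0# + fromℕ n  ∎)))

  0<fromℕ : ∀ {n} → 0 ℕ.< n → 0# < fromℕ n
  0<fromℕ {n} 0<n =
    0≤fromℕ n , λ 0≈fn → ℕ.<⇒≱ 0<n (fromℕ-cancel-≤ (≤-reflexive (sym 0≈fn)))

  sum-mono-≤ : ∀ {n} {f g : Fin n → Carrier} → (∀ i → f i ≤ g i) → sum f ≤ sum g
  sum-mono-≤ {zero}  f≤g = ≤-refl
  sum-mono-≤ {suc n} f≤g = +-mono-≤ (f≤g zero) (sum-mono-≤ (f≤g ∘ suc))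

  sum-fromℕ : ∀ {n} (f : Fin n → ℕ) →
              sum (fromℕ ∘ f) ≈ fromℕ (RawMonoidDefs.sum ℕ.+-0-rawMonoid f)
  sum-fromℕ {zero}  f = refl
  sum-fromℕ {suc n} f =
    trans (+-congˡ (sum-fromℕ (f ∘ suc))) (sym (×-homo-+ 1# (f zero) _))

  -- Lets the value of a knapsack with natural weights be estimated in ℕ.
  sum-if-fromℕ : ∀ {n} (f : Fin n → ℕ) (X : Subset n) →
                 sum (λ i → if lookup X i then fromℕ (f i) else 0#) ≈ fromℕ (total f X)
  sum-if-fromℕ f X = trans
    (sum-cong-≋ (λ i → reflexive (≡.sym (if-float fromℕ (lookup X i)))))
    (sum-fromℕ (λ i → if lookup X i then f i else 0))

-- Runs of decision trees: feasibility and the role of the first item.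

module PolicyProperties {c ℓ₁ ℓ₂} (K : ArchimedeanOrderedField c ℓ₁ ℓ₂)
                        (I : Knapsack.Instance K) where
  open ArchimedeanOrderedField K
  open Knapsack K
  open Instance I
  open OrderedFieldProperties K using (≤-trans; fromℕ-mono-≤)

  ⊆-run : ∀ C X {tried} (t : DecisionTree I tried) → X ⊆ run I C X t
  ⊆-run C X stop          i∈X = i∈X
  ⊆-run C X (try i _ t _) j∈X with fromℕ (totalSize X ℕ.+ size i) ≤? C
  ... | yes _ = ⊆-run C (X ∪ ⁅ i ⁆) t (p⊆p∪q ⁅ i ⁆ j∈X)
  ... | no  _ = j∈X

  run-feasible : ∀ C X {tried} (t : DecisionTree I tried) →
                 Feasible I C X → Feasible I C (run I C X t)
  run-feasible C X stop          X≤C = X≤C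
  run-feasible C X (try i _ t _) X≤C with fromℕ (totalSize X ℕ.+ size i) ≤? C
  ... | no  _     = X≤C
  -- The type of `run` does not relate `X` to the items tried, so `i` might already lie in `X`;
  -- subadditivity covers this case as well.
  ... | yes X+i≤C = run-feasible C (X ∪ ⁅ i ⁆) t (≤-trans (fromℕ-mono-≤ X∪i≤X+i) X+i≤C)
    where
    X∪i≤X+i : totalSize (X ∪ ⁅ i ⁆) ℕ.≤ totalSize X ℕ.+ size i
    X∪i≤X+i = ℕ.≤-trans (total-∪ size X ⁅ i ⁆)
                        (ℕ.≤-reflexive (≡.cong (totalSize X ℕ.+_) (total-⁅⁆ size i)))

  output-feasible : ∀ {C} → 0# ≤ C → ∀ π → Feasible I C (output I C π)
  output-feasible {C} 0≤C π =
    run-feasible C ⊥ π (≡.subst (λ s → fromℕ s ≤ C) (≡.sym (total-⊥ size)) 0≤C)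

  -- As a subset, since a policy may try nothing at all.
  first : Policy I → Subset items
  first stop          = ⊥
  first (try i _ _ _) = ⁅ i ⁆

  total-first-≤1 : ∀ π → total (const 1) (first π) ℕ.≤ 1
  total-first-≤1 stop          =
    ℕ.≤-trans (ℕ.≤-reflexive (total-⊥ {items} (const 1))) z≤n
  total-first-≤1 (try i _ _ _) = ℕ.≤-reflexive (total-⁅⁆ (const 1) i)

  -- If the first item does not fit, the process ends with nothing packed. If it fits, it is never
  -- removed again.
  output-nonempty⇒first : ∀ C π {i} → i ∈ output I C π →
                          ∃[ j ] (j ∈ first π × j ∈ output I C π)
  output-nonempty⇒first C stop          i∈out = contradiction i∈out ∉⊥
  output-nonempty⇒first C (try j _ t _) i∈out
    with fromℕ (totalSize ⊥ ℕ.+ size j) ≤? C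
  ... | yes _ = j , x∈⁅x⁆ j , ⊆-run C (⊥ ∪ ⁅ j ⁆) t (q⊆p∪q ⊥ ⁅ j ⁆ (x∈⁅x⁆ j))
  ... | no  _ = contradiction i∈out ∉⊥

-- The instance with exponential weights, and deterministic policies on it.

module HardInstance {c ℓ₁ ℓ₂} (K : ArchimedeanOrderedField c ℓ₁ ℓ₂) (D : ℕ) where
  open ArchimedeanOrderedField K hiding (sum; zero)
  open Knapsack K
  open OrderedFieldProperties K

  w : Fin (suc D) → ℕ
  w i = suc D ℕ.^ toℕ i

  I : Instance
  I = record
    { items         = suc D
    ; size          = λ i → suc (toℕ i)
    ; size-positive = λ i → s≤s z≤n
    ; weight        = fromℕ ∘ w
    ; weight-nonNeg = 0≤fromℕ ∘ w
    }

  open Instance I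
  open PolicyProperties K I

  capacity : Item → Carrier
  capacity i = fromℕ (size i)

  -- Item `i` fills the capacity by itself, and any other item has size at least 1.
  feasible-∋⇒⊆⁅⁆ : ∀ i {X} → Feasible I (capacity i) X → i ∈ X → X ⊆ ⁅ i ⁆
  feasible-∋⇒⊆⁅⁆ i {X} X≤C i∈X {j} j∈X with i Fin.≟ j
  ... | yes ≡.refl = x∈⁅x⁆ i
  ... | no  i≢j    = contradiction
    (ℕ.≤-trans (total-∈₂ size i∈X j∈X i≢j) (fromℕ-cancel-≤ X≤C))
    (ℕ.m+1+n≰m (size i))

  -- A packed item has size at most `size i`, hence index at most that of `i`. As `i` itself is
  -- absent, all indices are smaller and the geometric bound applies.
  feasible-∌⇒< : ∀ i {X} → Feasible I (capacity i) X → ¬ (i ∈ X) →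
                 D ℕ.* total w X ℕ.< w i
  feasible-∌⇒< i {X} X≤C i∉X = total-^-< D (toℕ i) X λ j∈X →
    ℕ.≤∧≢⇒< (ℕ.≤-pred (ℕ.≤-trans (total-∈ size j∈X) (fromℕ-cancel-≤ X≤C)))
            (λ j≡i → i∉X (≡.subst (_∈ X) (toℕ-injective j≡i) j∈X))

  feasible-∋⇒≤ : ∀ i {X} → Feasible I (capacity i) X → i ∈ X → total w X ℕ.≤ w i
  feasible-∋⇒≤ i X≤C i∈X = ℕ.≤-trans
    (total-mono-⊆ w (feasible-∋⇒⊆⁅⁆ i X≤C i∈X))
    (ℕ.≤-reflexive (total-⁅⁆ w i))

  value≈ : ∀ X → value X ≈ fromℕ (total w X)
  value≈ = sum-if-fromℕ w

  ⁅⁆-isOPT : 0 ℕ.< D → ∀ i → IsOPT I (capacity i) ⁅ i ⁆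
  ⁅⁆-isOPT 0<D i = ≤-reflexive (×-congˡ (total-⁅⁆ size i)) , λ Y Y≤C → begin
    value Y                ≈⟨ value≈ Y ⟩
    fromℕ (total w Y)      ≤⟨ fromℕ-mono-≤ (bound Y Y≤C) ⟩
    fromℕ (w i)            ≈⟨ ×-congˡ (total-⁅⁆ w i) ⟨
    fromℕ (total w ⁅ i ⁆)  ≈⟨ value≈ ⁅ i ⁆ ⟨
    value ⁅ i ⁆            ∎
    where
    bound : ∀ Y → Feasible I (capacity i) Y → total w Y ℕ.≤ w i
    bound Y Y≤C with i ∈? Y
    ... | yes i∈Y = feasible-∋⇒≤ i Y≤C i∈Y
    -- Since `D` is at least 1, the factor `D` can be inserted before the bound on lighter items is
    -- used.
    ... | no  i∉Y = ℕ.≤-trans (ℕ.m≤n*m _ D {{ℕ.>-nonZero 0<D}})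
                              (ℕ.<⇒≤ (feasible-∌⇒< i Y≤C i∉Y))

  -- Valued in ℕ so that its sum over all items is by definition `total (const 1) (first π)`.
  triedFirst : Policy I → Item → ℕ
  triedFirst π i = if lookup (first π) i then 1 else 0

  triedFirst≡1 : ∀ {π i} → i ∈ first π → triedFirst π i ≡ 1
  triedFirst≡1 i∈first rewrite []=⇒lookup i∈first = ≡.refl

  -- The bound Mⁱ (q i + 1/D) for a single policy, where q i is 0 or 1, multiplied by `D` to stay in
  -- ℕ.
  output-total-≤ : ∀ i π → D ℕ.* total w (output I (capacity i) π) ℕ.≤
                           w i ℕ.* (D ℕ.* triedFirst π i ℕ.+ 1)
  output-total-≤ i π with i ∈? output I (capacity i) π
                        | output-feasible (0≤fromℕ (size i)) π
  ... | no i∉out  | out≤C = ℕ.≤-trans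
    (ℕ.<⇒≤ (feasible-∌⇒< i out≤C i∉out))
    -- When `i` is not packed, the summand 1 alone makes the second factor positive.
    (ℕ.m≤m*n (w i) _ {{ℕ.>-nonZero (ℕ.m≤n+m 1 _)}})
  ... | yes i∈out | out≤C
    with j , j∈first , j∈out ← output-nonempty⇒first (capacity i) π i∈out
    -- The first item tried is packed too, and the output contains nothing but `i`, so `i` was tried
    -- first.
    with ≡.refl ← x∈⁅y⁆⇒x≡y i (feasible-∋⇒⊆⁅⁆ i out≤C i∈out j∈out)
    rewrite triedFirst≡1 {π} j∈first = ℕ.≤-trans
      (ℕ.*-monoʳ-≤ D (feasible-∋⇒≤ i out≤C i∈out))
      (ℕ.≤-trans (ℕ.≤-reflexive (ℕ.*-comm D (w i)))
                 (ℕ.*-monoʳ-≤ (w i) (ℕ.≤-trans (ℕ.m≤m*n D 1) (ℕ.m≤m+n _ 1))))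

  -- Averaging over a randomized policy.

  module _ (P : RandomizedPolicy I) where
    open RandomizedPolicy P

    -- The probability q i, written as the expectation of an indicator.
    probFirst : Item → Carrier
    probFirst i = ∑[ k < outcomes ] (prob k * fromℕ (triedFirst (policy k) i))

    -- After exchanging the sums, each policy contributes at most its own probability, because it
    -- tries at most one item first.
    sum-probFirst-≤1 : ∑[ i < items ] probFirst i ≤ 1#
    sum-probFirst-≤1 = begin
      ∑[ i < items ] ∑[ k < outcomes ] (prob k * ind k i)
        ≈⟨ ∑-comm (λ i k → prob k * ind k i) ⟩
      ∑[ k < outcomes ] ∑[ i < items ] (prob k * ind k i)
        ≤⟨ sum-mono-≤ sum-ind-≤ ⟩
      sum prob
        ≈⟨ prob-sum ⟩
      1# ∎
      where
      ind : Fin outcomes → Item → Carrier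
      ind k i = fromℕ (triedFirst (policy k) i)

      sum-ind-≤ : ∀ k → ∑[ i < items ] (prob k * ind k i) ≤ prob k
      sum-ind-≤ k = begin
        ∑[ i < items ] (prob k * ind k i)               ≈⟨ *-distribˡ-sum (prob k) (ind k) ⟨
        prob k * ∑[ i < items ] ind k i                 ≈⟨ *-congˡ (sum-fromℕ (triedFirst (policy k))) ⟩
        prob k * fromℕ (total (const 1) (first (policy k)))
          ≤⟨ *-monoˡ-≤ (prob-nonNeg k) (fromℕ-mono-≤ (total-first-≤1 (policy k))) ⟩
        prob k * fromℕ 1                                ≈⟨ *-congˡ (×-homo-1 1#) ⟩
        prob k * 1#                                     ≈⟨ *-identityʳ (prob k) ⟩
        prob k                                          ∎

    -- This is `output-total-≤` averaged over the policies; the summand 1 survives because the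
    -- probabilities add up to 1.
    expectedValue-≤ : ∀ i → fromℕ D * expectedValue (capacity i) ≤
                            fromℕ (w i) * (fromℕ D * probFirst i + 1#)
    expectedValue-≤ i = begin
      fromℕ D * ∑[ k < outcomes ] (prob k * v k)
        ≈⟨ *-distribˡ-sum (fromℕ D) (λ k → prob k * v k) ⟩
      ∑[ k < outcomes ] (fromℕ D * (prob k * v k))
        ≤⟨ sum-mono-≤ bound ⟩
      ∑[ k < outcomes ] (fromℕ (w i) * (fromℕ D * (prob k * ind k) + prob k))
        ≈⟨ *-distribˡ-sum (fromℕ (w i)) (λ k → fromℕ D * (prob k * ind k) + prob k) ⟨
      fromℕ (w i) * ∑[ k < outcomes ] (fromℕ D * (prob k * ind k) + prob k)
        ≈⟨ *-congˡ (∑-distrib-+ (λ k → fromℕ D * (prob k * ind k)) prob) ⟩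
      fromℕ (w i) * (∑[ k < outcomes ] (fromℕ D * (prob k * ind k)) + sum prob)
        ≈⟨ *-congˡ (+-cong (sym (*-distribˡ-sum (fromℕ D) (λ k → prob k * ind k))) prob-sum) ⟩
      fromℕ (w i) * (fromℕ D * probFirst i + 1#) ∎
      where
      v ind : Fin outcomes → Carrier
      v k = value (output I (capacity i) (policy k))
      ind k = fromℕ (triedFirst (policy k) i)

      bound : ∀ k → fromℕ D * (prob k * v k) ≤
                    fromℕ (w i) * (fromℕ D * (prob k * ind k) + prob k)
      bound k = begin
        fromℕ D * (p * v k)                            ≈⟨ x∙yz≈y∙xz _ _ _ ⟩
        p * (fromℕ D * v k)                            ≈⟨ *-congˡ (*-congˡ (value≈ X)) ⟩
        p * (fromℕ D * fromℕ (total w X))              ≈⟨ *-congˡ (×1-homo-* D (total w X)) ⟨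
        p * fromℕ (D ℕ.* total w X)                    ≤⟨ *-monoˡ-≤ (prob-nonNeg k) (fromℕ-mono-≤ (output-total-≤ i (policy k))) ⟩
        p * fromℕ (w i ℕ.* (D ℕ.* t ℕ.+ 1))            ≈⟨ *-congˡ (×1-homo-* (w i) _) ⟩
        p * (fromℕ (w i) * fromℕ (D ℕ.* t ℕ.+ 1))      ≈⟨ x∙yz≈y∙xz _ _ _ ⟩
        fromℕ (w i) * (p * fromℕ (D ℕ.* t ℕ.+ 1))      ≈⟨ *-congˡ (*-congˡ (×-homo-+ 1# (D ℕ.* t) 1)) ⟩
        fromℕ (w i) * (p * (fromℕ (D ℕ.* t) + fromℕ 1)) ≈⟨ *-congˡ (*-congˡ (+-cong (×1-homo-* D t) (×-homo-1 1#))) ⟩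
        fromℕ (w i) * (p * (fromℕ D * ind k + 1#))     ≈⟨ *-congˡ (distribˡ p _ 1#) ⟩
        fromℕ (w i) * (p * (fromℕ D * ind k) + p * 1#) ≈⟨ *-congˡ (+-cong (x∙yz≈y∙xz _ _ _) (*-identityʳ p)) ⟩
        fromℕ (w i) * (fromℕ D * (p * ind k) + p)      ∎
        where
        p = prob k
        X = output I (capacity i) (policy k)
        t = triedFirst (policy k) i

    ¬robust : ∀ {α} → fromℕ 2 ≤ fromℕ D * α → 0 ℕ.< D → ¬ Robust I α P
    -- The chain below counts one unit per item, D + 1 in all, against D times a total probability
    -- of at most 1.
    ¬robust {α} 2≤Dα 0<D robust = ℕ.n≮n D (fromℕ-cancel-≤ (begin
      fromℕ (suc D)                            ≈⟨ sum-replicate items ⟨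
      ∑[ i < items ] 1#                        ≤⟨ sum-mono-≤ 1≤D*probFirst ⟩
      ∑[ i < items ] (fromℕ D * probFirst i)   ≈⟨ *-distribˡ-sum (fromℕ D) probFirst ⟨
      fromℕ D * ∑[ i < items ] probFirst i     ≤⟨ *-monoˡ-≤ (0≤fromℕ D) sum-probFirst-≤1 ⟩
      fromℕ D * 1#                             ≈⟨ *-identityʳ (fromℕ D) ⟩
      fromℕ D                                  ∎))
      where
      robust′ : ∀ i → α * fromℕ (w i) ≤ expectedValue (capacity i)
      robust′ i = begin
        α * fromℕ (w i)              ≈⟨ *-congˡ (×-congˡ (total-⁅⁆ w i)) ⟨
        α * fromℕ (total w ⁅ i ⁆)    ≈⟨ *-congˡ (value≈ ⁅ i ⁆) ⟨
        α * value ⁅ i ⁆              ≤⟨ robust (capacity i) (0≤fromℕ (size i)) ⁅ i ⁆ (⁅⁆-isOPT 0<D i) ⟩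
        expectedValue (capacity i)   ∎

      1≤D*probFirst : ∀ i → 1# ≤ fromℕ D * probFirst i
      -- Of the 2 supplied by `2≤Dα`, one unit pays for the lighter items and the other is left for
      -- q i. The common factor Mⁱ is positive and cancels.
      1≤D*probFirst i = +-cancelʳ-≤ 1# (begin
        1# + 1#                      ≈⟨ +-congˡ (×-homo-1 1#) ⟨
        fromℕ 2                      ≤⟨ *-cancelˡ-≤ (0<fromℕ (ℕ.m^n>0 (suc D) (toℕ i))) (begin
          fromℕ (w i) * fromℕ 2         ≤⟨ *-monoˡ-≤ (0≤fromℕ (w i)) 2≤Dα ⟩
          fromℕ (w i) * (fromℕ D * α)   ≈⟨ x∙yz≈y∙xz _ _ _ ⟩
          fromℕ D * (fromℕ (w i) * α)   ≈⟨ *-congˡ (*-comm _ α) ⟩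
          fromℕ D * (α * fromℕ (w i))   ≤⟨ *-monoˡ-≤ (0≤fromℕ D) (robust′ i) ⟩
          fromℕ D * expectedValue (capacity i) ≤⟨ expectedValue-≤ i ⟩
          fromℕ (w i) * (fromℕ D * probFirst i + 1#) ∎) ⟩
        fromℕ D * probFirst i + 1#   ∎)

-- Choice of the instance for a given ratio.

theorem6 : ∀ {c ℓ₁ ℓ₂} (K : ArchimedeanOrderedField c ℓ₁ ℓ₂) →
    let open ArchimedeanOrderedField K
        open Knapsack K
    in ∀ (α : Carrier) → 0# < α →
       Σ[ I ∈ Instance ] ¬ (Σ[ P ∈ RandomizedPolicy I ] Robust I α P)
theorem6 K α (0≤α , 0≉α)
  with y , αy≈1 ← ArchimedeanOrderedField.inverse K α (λ α≈0 → 0≉α (ArchimedeanOrderedField.sym K α≈0))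
  with N , y≤N ← ArchimedeanOrderedField.archimedean K y
  -- `N` bounds 1/α from above, so the factor 2 yields D α ≥ 2; the successor makes `D` visibly
  -- positive.
  = HardInstance.I K (2 ℕ.* suc N) , λ (P , robust) →
    HardInstance.¬robust K (2 ℕ.* suc N) P 2≤Dα (s≤s z≤n) robust
  where
  open ArchimedeanOrderedField K hiding (sum; zero)
  open OrderedFieldProperties K
  2≤Dα : fromℕ 2 ≤ fromℕ (2 ℕ.* suc N) * α
  2≤Dα = begin
    fromℕ 2                        ≈⟨ *-identityʳ (fromℕ 2) ⟨
    fromℕ 2 * 1#                   ≈⟨ *-congˡ αy≈1 ⟨
    fromℕ 2 * (α * y)              ≤⟨ *-monoˡ-≤ (0≤fromℕ 2) (*-monoˡ-≤ 0≤α (≤-trans y≤N (fromℕ-mono-≤ (ℕ.n≤1+n N)))) ⟩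
    fromℕ 2 * (α * fromℕ (suc N))  ≈⟨ *-congˡ (*-comm α _) ⟩
    fromℕ 2 * (fromℕ (suc N) * α)  ≈⟨ *-assoc _ _ α ⟨
    fromℕ 2 * fromℕ (suc N) * α    ≈⟨ *-congʳ (×1-homo-* 2 (suc N)) ⟨
    fromℕ (2 ℕ.* suc N) * α        ∎
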